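{- Let $k\ge 1$ and let $\pi=011\cdots 1$ be the pattern consisting of a zero followed by $k$ ones. Then for all $n\ge 1$, \[ |\mathbf{I}_n(\pi)| = |L'_{n+1,k-1}|. \]
   Context: An inversion sequence of length $n$ is a sequence of integers $e=e_1\cdots e_n$ with $0\le e_i<i$ for all $1\le i\le n$; the set of these is $\mathbf{I}_n$. A sequence $e$ contains a pattern (finite integer sequence) $\pi$ of length $m$ if there are indices $i_1<\cdots<i_m$ such that $e_{i_1}\cdots e_{i_m}$ is order isomorphic to $\pi$ (i.e. its entries compare pairwise, with respect to $<,=,>$, exactly as the corresponding entries of $\pi$); otherwise it avoids $\pi$. $\mathbf{I}_n(\pi)$ is the set of $e\in\mathbf{I}_n$ avoiding $\pi$. A label-increasing tree on $n$ vertices is a rooted unordered tree in which the $n$ vertices are labeled with distinct labels from $\{0,\dots,n-1\}$ and labels increase along any path from the root to a leaf. $L'_{n,k}$ denotes the set of $n$-vertex label-increasing trees in which every vertex other than the root has at most $k$ children (the number of children of the root is unrestricted). -}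

module Defs where

open import Level using (0ℓ)
open import Data.Nat.Base using (ℕ; suc; _≤_; _<_; _>_)
open import Data.Fin.Base as Fin using (Fin; toℕ)
open import Data.Fin.Subset using (Subset; _∈_; ∣_∣; Empty)
open import Data.List.Base using (List; []; _∷_)
open import Data.List.Relation.Unary.Linked using (Linked)
open import Data.Product using (Σ; ∃; _×_; proj₁)
open import Data.Vec.Base using (Vec; _∷_; lookup; tabulate; replicate)
open import Function.Bundles using (Inverse; _⇔_)
open import Relation.Binary.Bundles using (Setoid)
open import Relation.Binary.Construct.Closure.ReflexiveTransitive using (Star; ε; _◅_)
import Relation.Binary.Construct.On as On
open import Relation.Binary.PropositionalEquality using (_≡_; _≢_; setoid)
open import Relation.Nullary using (¬_)
open import Relation.Unary using (Pred)

-- The elements of A satisfying P, compared as elements of A: two proofs of P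
-- for the same element do not count twice.
subsetoid : ∀ {a p} {A : Set a} → Pred A p → Setoid _ _
subsetoid {A = A} P = On.setoid {B = Σ A P} (setoid A) proj₁

HasCardinality : ∀ {a p} {A : Set a} → Pred A p → ℕ → Set _
HasCardinality P m = Inverse (subsetoid P) (setoid (Fin m))

-- Positions are indexed from 0, so the bound e_i < i (for i ≥ 1) becomes
-- lookup e i < suc (toℕ i).
IsInversionSequence : ∀ {n} → Pred (Vec ℕ n) 0ℓ
IsInversionSequence {n} e = ∀ (i : Fin n) → lookup e i < suc (toℕ i)

OrderIsomorphic : ∀ {m} → Vec ℕ m → Vec ℕ m → Set
OrderIsomorphic {m} xs ys = ∀ (i j : Fin m) →
  (lookup xs i < lookup xs j ⇔ lookup ys i < lookup ys j) ×
  (lookup xs i ≡ lookup xs j ⇔ lookup ys i ≡ lookup ys j) ×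
  (lookup xs i > lookup xs j ⇔ lookup ys i > lookup ys j)

Contains : ∀ {n m} → Vec ℕ n → Vec ℕ m → Set
Contains {n} {m} e π = ∃ λ (ι : Fin m → Fin n) →
  (∀ {a b} → a Fin.< b → ι a Fin.< ι b) ×
  OrderIsomorphic (tabulate (λ a → lookup e (ι a))) π

Avoids : ∀ {n m} → Vec ℕ n → Vec ℕ m → Set
Avoids e π = ¬ Contains e π

𝐈 : ∀ (n : ℕ) {m} → Vec ℕ m → Pred (Vec ℕ n) 0ℓ
𝐈 n π e = IsInversionSequence e × Avoids e π

zeroThenOnes : (k : ℕ) → Vec ℕ (suc k)
zeroThenOnes k = 0 ∷ replicate k 1

-- Labels are distinct and exhaust {0,…,N-1}, so each vertex is identified with
-- its label; children are sets, so siblings carry no order.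
record RootedDigraph (N : ℕ) : Set where
  constructor rooted
  field
    root     : Fin N
    childSet : Vec (Subset N) N

  children : Fin N → Subset N
  children = lookup childSet

  _HasChild_ : Fin N → Fin N → Set
  u HasChild v = v ∈ children u

  Path : Fin N → Fin N → Set
  Path = Star _HasChild_

  labels : ∀ {u v} → Path u v → List (Fin N)
  labels {u} ε       = u ∷ []
  labels {u} (_ ◅ p) = u ∷ labels p

  IsLeaf : Fin N → Set
  IsLeaf v = Empty (children v)

open RootedDigraph

-- Rooted tree, with edges directed away from the root: every vertex is joined
-- to the root by exactly one directed path.  Paths may a priori repeat
-- vertices, so this excludes cycles and edges into the root.
IsRootedTree : ∀ {N} → Pred (RootedDigraph N) 0ℓ
IsRootedTree t = ∀ v → ∃ λ (p : Path t (root t) v) → ∀ q → p ≡ q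

IsLabelIncreasing : ∀ {N} → Pred (RootedDigraph N) 0ℓ
IsLabelIncreasing t =
  ∀ {v} → IsLeaf t v → (p : Path t (root t) v) → Linked Fin._<_ (labels t p)

L′ : (N k : ℕ) → Pred (RootedDigraph N) 0ℓ
L′ N k t = IsRootedTree t × IsLabelIncreasing t ×
  (∀ v → v ≢ root t → ∣ children t v ∣ ≤ k)

-- Send e to the tree on {0,…,n} in which the parent of i + 1 is the value of e at
-- the (0-indexed) position i.  The bound on the entries says exactly that parents
-- have smaller labels, and v has as many children as it has occurrences in e.
-- Since e starts with 0, a value v > 0 occurring k times yields the pattern 01⋯1,
-- while the pattern makes its repeated value occur k times; so avoidance says that
-- every v > 0 has at most k − 1 children.
module Submission where

open import Data.Bool.Base using (true)
open import Data.Fin.Base as Fin using (Fin; zero; suc; toℕ; fromℕ<)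
open import Data.Fin.Induction using (spo-noetherian; <-wellFounded)
import Data.Fin.Properties as Fin
open import Data.Fin.Subset using (Subset; inside; outside; _∈_; _⊆_; ∣_∣)
open import Data.Fin.Subset.Properties using (nonempty?; ⊆-antisym)
open import Data.List.Base as List using (List; []; _∷_; upTo; cartesianProductWith; filter)
open import Data.List.Membership.Propositional as List using ()
open import Data.List.Membership.Propositional.Properties
  using (∈-lookup; ∈-cartesianProductWith⁺; ∈-upTo⁺; ∈-filter⁺; ∈-filter⁻; ∈-deduplicate⁺; ∈-deduplicate⁻)
import Data.List.Relation.Unary.All as All
open import Data.List.Relation.Unary.AllPairs using (_∷_)
open import Data.List.Relation.Unary.Any as Any using (here)
open import Data.List.Relation.Unary.Any.Properties using (lookup-index)
open import Data.List.Relation.Unary.Linked as Linked using (Linked; [-]; _∷_)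
open import Data.List.Relation.Unary.Unique.DecPropositional.Properties using (deduplicate-!)
open import Data.List.Relation.Unary.Unique.Propositional using (Unique)
open import Data.Nat using (ℕ; zero; suc; _∸_; _≤_; _<_; _*_; z≤n; s≤s; s≤s⁻¹; z<s; s<s; s<s⁻¹; _≟_; _≤?_; _<?_)
open import Data.Nat.Properties
  using (≤-refl; ≤-reflexive; ≤-trans; <-trans; <-≤-trans; ≤-<-trans; <⇒≤; <-irrefl; n≮0; ≮⇒≥; n≤0⇒n≡0;
         *-cancelʳ-<; *-cancelʳ-≡; *-monoˡ-<; *-identityˡ; <-isStrictPartialOrder)
open import Data.Product using (Σ; ∃; _×_; _,_; proj₁; proj₂)
open import Data.Vec.Base using (Vec; []; _∷_; lookup; tabulate; replicate; here; there)
open import Data.Vec.Properties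
  using (lookup⇒[]=; []=⇒lookup; lookup∘tabulate; lookup-replicate; tabulate-cong; tabulate∘lookup; ≡-dec)
open import Data.Vec.Properties.WithK using ([]=-irrelevant)
open import Function.Base using (_∘_; flip)
open import Function.Bundles using (Inverse; _⇔_; mk⇔; Equivalence)
open import Induction.WellFounded using (Acc; acc)
open import Relation.Binary.Construct.Closure.ReflexiveTransitive using (ε; _◅_; _◅◅_)
import Relation.Binary.Construct.On as On
open import Relation.Binary.Definitions using (DecidableEquality)
open import Relation.Binary.PropositionalEquality
open import Relation.Nullary using (¬_; Dec; yes; no; does; contradiction; ¬?)
open import Relation.Nullary.Decidable using (dec-true; map′; _×-dec_; _→-dec_)
open import Relation.Unary using (Pred; Decidable)

open import Defs

-- Cardinalities

module _ {a} {A : Set a} where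

  Unique⇒lookup-injective : ∀ {xs : List A} → Unique xs → ∀ i j →
    List.lookup xs i ≡ List.lookup xs j → i ≡ j
  Unique⇒lookup-injective (_ ∷ _)   zero    zero    _  = refl
  Unique⇒lookup-injective (x∉ ∷ _)  zero    (suc j) eq = contradiction eq (All.lookup x∉ (∈-lookup j))
  Unique⇒lookup-injective (x∉ ∷ _)  (suc i) zero    eq = contradiction (sym eq) (All.lookup x∉ (∈-lookup i))
  Unique⇒lookup-injective (_ ∷ !xs) (suc i) (suc j) eq = cong suc (Unique⇒lookup-injective !xs i j eq)

  Unique⇒HasCardinality : ∀ {p} {P : Pred A p} {xs} → Unique xs →
    (∀ {x} → P x → x List.∈ xs) → (∀ {x} → x List.∈ xs → P x) →
    HasCardinality P (List.length xs)
  Unique⇒HasCardinality {P = P} {xs} !xs P⇒∈ ∈⇒P = record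
    { to        = to
    ; from      = λ i → List.lookup xs i , ∈⇒P (∈-lookup i)
    -- The index is read off a proof of `P`, so two proofs for one element might give different
    -- indices; a list without repetitions excludes this.
    ; to-cong   = λ {x} {y} x≡y → Unique⇒lookup-injective !xs _ _
                    (trans (lookup-to x) (trans x≡y (sym (lookup-to y))))
    ; from-cong = cong (List.lookup xs)
    ; inverse   = (λ {i} {y} y≡ → Unique⇒lookup-injective !xs _ _ (trans (lookup-to y) y≡))
                , (λ { {x} refl → lookup-to x })
    }
    where
    to : Σ A P → Fin (List.length xs)
    to (_ , Px) = Any.index (P⇒∈ Px)
    lookup-to : ∀ x → List.lookup xs (to x) ≡ proj₁ x
    lookup-to (_ , Px) = sym (lookup-index (P⇒∈ Px))

  -- The list has only to cover `P`: filtering removes foreign elements, deduplication removes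
  -- repetitions, and the length of the rest is the cardinality.
  decidable⇒HasCardinality : ∀ {p} {P : Pred A p} → DecidableEquality A → Decidable P →
    (xs : List A) → (∀ {x} → P x → x List.∈ xs) → ∃ (HasCardinality P)
  decidable⇒HasCardinality _≟ᴬ_ P? xs P⇒∈ = _ , Unique⇒HasCardinality (deduplicate-! _≟ᴬ_ (filter P? xs))
    (λ Px → ∈-deduplicate⁺ _≟ᴬ_ (∈-filter⁺ P? (P⇒∈ Px) Px))
    (λ x∈ → proj₂ (∈-filter⁻ P? {xs = xs} (∈-deduplicate⁻ _≟ᴬ_ (filter P? xs) x∈)))

HasCardinality-bijection : ∀ {a b p q} {A : Set a} {B : Set b} {P : Pred A p} {Q : Pred B q} {c}
  (f : A → B) → (∀ {x} → P x → Q (f x)) →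
  (∀ {x y} → P x → P y → f x ≡ f y → x ≡ y) →
  (∀ {y} → Q y → ∃ λ x → P x × f x ≡ y) →
  HasCardinality P c → HasCardinality Q c
HasCardinality-bijection {P = P} {Q} f P⇒Q injective surjective card = record
  { to        = λ y → I.to (g y)
  ; from      = λ i → f (proj₁ (I.from i)) , P⇒Q (proj₂ (I.from i))
  -- The chosen preimage may depend on the proof of `Q`; injectivity of `f` makes the choice
  -- harmless.
  ; to-cong   = λ {y} {z} y≡z → I.to-cong (injective (proj₂ (g y)) (proj₂ (g z))
                  (trans (fg y) (trans y≡z (sym (fg z)))))
  ; from-cong = λ i≡j → cong f (I.from-cong i≡j)
  ; inverse   = (λ {i} {y} y≡ → I.inverseˡ (injective (proj₂ (g y)) (proj₂ (I.from i)) (trans (fg y) y≡)))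
              , (λ {y} i≡ → trans (cong f (I.inverseʳ i≡)) (fg y))
  }
  where
  module I = Inverse card
  g : Σ _ Q → Σ _ P
  g (_ , Qy) = proj₁ (surjective Qy) , proj₁ (proj₂ (surjective Qy))
  fg : ∀ y → f (proj₁ (g y)) ≡ proj₁ y
  fg (_ , Qy) = proj₂ (proj₂ (surjective Qy))

boundedVecs : ∀ m n → List (Vec ℕ n)
boundedVecs m zero    = [] ∷ []
boundedVecs m (suc n) = cartesianProductWith _∷_ (upTo m) (boundedVecs m n)

∈-boundedVecs : ∀ {m n} (xs : Vec ℕ n) → (∀ i → lookup xs i < m) → xs List.∈ boundedVecs m n
∈-boundedVecs []       xs< = here refl
∈-boundedVecs (x ∷ xs) xs< =
  ∈-cartesianProductWith⁺ _∷_ (∈-upTo⁺ (xs< zero)) (∈-boundedVecs xs (xs< ∘ suc))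

-- Increasing enumerations of subsets

Increasing : ∀ {k n} → (Fin k → Fin n) → Set
Increasing ι = ∀ {a b} → a Fin.< b → ι a Fin.< ι b

-- Supplies positions for the ones of the pattern: scanning from the front, the first `k` members
-- are taken.
enumerate : ∀ {n} k (s : Subset n) → k ≤ ∣ s ∣ →
  ∃ λ (ι : Fin k → Fin n) → Increasing ι × (∀ a → ι a ∈ s)
enumerate zero    s             _  = (λ ()) , (λ { {()} }) , λ ()
enumerate (suc k) (outside ∷ s) k≤ =
  let ι , ι< , ι∈ = enumerate (suc k) s k≤ in suc ∘ ι , s<s ∘ ι< , there ∘ ι∈
enumerate {suc n} (suc k) (inside ∷ s)  k≤ = ι′ , ι′< , ι′∈
  where
  rec = enumerate k s (s≤s⁻¹ k≤)
  ι′ : Fin (suc k) → Fin (suc n)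
  ι′ zero    = zero
  ι′ (suc a) = suc (proj₁ rec a)
  ι′< : Increasing ι′
  ι′< {zero}  {suc b} _   = z<s
  ι′< {suc a} {suc b} a<b = s<s (proj₁ (proj₂ rec) (s<s⁻¹ a<b))
  ι′∈ : ∀ a → ι′ a ∈ (inside ∷ s)
  ι′∈ zero    = here
  ι′∈ (suc a) = there (proj₂ (proj₂ rec) a)

lower : ∀ {k n} (ι : Fin k → Fin (suc n)) → (∀ a → zero {n} Fin.< ι a) →
  ∃ λ (ι′ : Fin k → Fin n) → ∀ a → suc (ι′ a) ≡ ι a
lower ι ι>0 = (λ a → proj₁ (pred (ι>0 a))) , λ a → proj₂ (pred (ι>0 a))
  where
  pred : ∀ {n} {i : Fin (suc n)} → zero {n} Fin.< i → ∃ λ j → suc j ≡ i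
  pred {i = suc j} _ = j , refl

-- Induction on the subset. If the head is `inside`, the first index is dropped: all later values
-- exceed `ι zero`, hence are positive and lie in the tail. If the head is `outside`, membership
-- alone makes every value positive.
increasing⇒≤∣∣ : ∀ {k n} (s : Subset n) (ι : Fin k → Fin n) →
  Increasing ι → (∀ a → ι a ∈ s) → k ≤ ∣ s ∣

increasing⇒≤∣tail∣ : ∀ {k n x} (s : Subset n) (ι : Fin k → Fin (suc n)) →
  Increasing ι → (∀ a → ι a ∈ (x ∷ s)) → (∀ a → zero {n} Fin.< ι a) → k ≤ ∣ s ∣
increasing⇒≤∣tail∣ s ι ι< ι∈ ι>0 with lower ι ι>0
... | ι′ , suc-ι′ = increasing⇒≤∣∣ s ι′
  (λ {a} {b} a<b → s<s⁻¹ (subst₂ Fin._<_ (sym (suc-ι′ a)) (sym (suc-ι′ b)) (ι< a<b)))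
  (λ a → tail∈ (subst (_∈ _) (sym (suc-ι′ a)) (ι∈ a)))
  where
  tail∈ : ∀ {n x} {i : Fin n} {s : Subset n} → suc i ∈ (x ∷ s) → i ∈ s
  tail∈ (there i∈s) = i∈s

increasing⇒≤∣∣ {zero}  s             ι ι< ι∈ = z≤n
increasing⇒≤∣∣ {suc k} []            ι ι< ι∈ with () ← ι zero
increasing⇒≤∣∣ {suc k} (inside ∷ s)  ι ι< ι∈ =
  s≤s (increasing⇒≤∣tail∣ s (ι ∘ suc) (ι< ∘ s<s) (ι∈ ∘ suc) (λ a → ≤-<-trans z≤n (ι< {zero} {suc a} z<s)))
increasing⇒≤∣∣ {suc k} (outside ∷ s) ι ι< ι∈ = increasing⇒≤∣tail∣ s ι ι< ι∈ (λ a → positive (ι∈ a))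
  where
  positive : ∀ {n} {i : Fin (suc n)} {s : Subset n} → i ∈ (outside ∷ s) → zero {n} Fin.< i
  positive (there _) = z<s

-- Avoidance as a bound on multiplicities

-- A subset rather than a count, since these positions, shifted by one, become the child set of a
-- vertex.
occurrences : ∀ {n} → Vec ℕ n → ℕ → Subset n
occurrences e v = tabulate λ i → does (lookup e i ≟ v)

∈-occurrences⁺ : ∀ {n} (e : Vec ℕ n) {v i} → lookup e i ≡ v → i ∈ occurrences e v
∈-occurrences⁺ e {v} {i} eq =
  lookup⇒[]= i _ (trans (lookup∘tabulate _ i) (dec-true (lookup e i ≟ v) eq))

∈-occurrences⁻ : ∀ {n} (e : Vec ℕ n) {v i} → i ∈ occurrences e v → lookup e i ≡ v
∈-occurrences⁻ e {v} {i} i∈ =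
  witness (lookup e i ≟ v) (trans (sym (lookup∘tabulate _ i)) ([]=⇒lookup i∈))
  where
  witness : ∀ {a} {A : Set a} (A? : Dec A) → does A? ≡ true → A
  witness (yes a) _ = a

-- The values range over the vertices of the future tree, so the condition matches its degree bound
-- vertex by vertex and is a finite check. No entry of an inversion sequence is missed, as all are
-- below `n`.
Sparse : ∀ {n} → ℕ → Pred (Vec ℕ n) _
Sparse {n} k e = ∀ (v : Fin (suc n)) → v ≢ zero → ∣ occurrences e (toℕ v) ∣ ≤ k

sparse? : ∀ {n} k → Decidable (Sparse {n} k)
sparse? k e = Fin.all? λ v → ¬? (v Fin.≟ zero) →-dec (∣ occurrences e (toℕ v) ∣ ≤? k)

inversionSequence? : ∀ {n} → Decidable (IsInversionSequence {n})
inversionSequence? e = Fin.all? λ i → lookup e i <? suc (toℕ i)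

-- Multiplication by a positive number preserves and reflects order and equality. It carries the
-- pattern 01...1 to 0 followed by copies of `suc v`, which avoids a case split on positions.
scaled⇒OrderIsomorphic : ∀ {m} v (xs ys : Vec ℕ m) →
  (∀ i → lookup xs i ≡ lookup ys i * suc v) → OrderIsomorphic xs ys
scaled⇒OrderIsomorphic v xs ys xs≡ i j
  rewrite xs≡ i | xs≡ j
  = <⇔ (lookup ys i) (lookup ys j)
  , mk⇔ (*-cancelʳ-≡ (lookup ys i) (lookup ys j) (suc v)) (cong (_* suc v))
  , <⇔ (lookup ys j) (lookup ys i)
  where
  <⇔ : ∀ x y → (x * suc v < y * suc v) ⇔ (x < y)
  <⇔ x y = mk⇔ (*-cancelʳ-< (suc v) x y) (*-monoˡ-< (suc v))

avoids⇒sparse : ∀ {n} k (e : Vec ℕ n) → IsInversionSequence e →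
  Avoids e (zeroThenOnes (suc k)) → Sparse k e
avoids⇒sparse k e inv avoids zero v≢0 = contradiction refl v≢0
avoids⇒sparse {suc n} k e inv avoids (suc v) _ =
  ≮⇒≥ λ k< → avoids (contained (enumerate (suc k) (occurrences e (suc (toℕ v))) k<))
  where
  e₀≡0 : lookup e zero ≡ 0
  e₀≡0 = n≤0⇒n≡0 (s≤s⁻¹ (inv zero))
  contained : (∃ λ ι → Increasing ι × (∀ a → ι a ∈ occurrences e (suc (toℕ v)))) →
    Contains e (zeroThenOnes (suc k))
  contained (ι , ι< , ι∈) = ι′ , ι′< , scaled⇒OrderIsomorphic (toℕ v) (tabulate (lookup e ∘ ι′)) (zeroThenOnes (suc k)) scaled
    where
    ι′ : Fin (suc (suc k)) → Fin (suc n)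
    -- The first entry is 0, so position `zero` plays the zero of the pattern, and occurrences of a
    -- nonzero value all come after it.
    ι′ zero    = zero
    ι′ (suc a) = ι a
    positive : ∀ {i : Fin (suc n)} → lookup e i ≡ suc (toℕ v) → zero {n} Fin.< i
    positive {zero}  eq with () ← trans (sym e₀≡0) eq
    positive {suc i} _  = z<s
    ι′< : Increasing ι′
    ι′< {zero}  {suc b} _   = positive (∈-occurrences⁻ e (ι∈ b))
    ι′< {suc a} {suc b} a<b = ι< (s<s⁻¹ a<b)
    scaled : ∀ a → lookup (tabulate (lookup e ∘ ι′)) a ≡
                   lookup (zeroThenOnes (suc k)) a * suc (toℕ v)
    scaled zero    = e₀≡0
    scaled (suc a) = begin
      lookup (tabulate (lookup e ∘ ι)) a    ≡⟨ lookup∘tabulate (lookup e ∘ ι) a ⟩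
      lookup e (ι a)                                ≡⟨ ∈-occurrences⁻ e (ι∈ a) ⟩
      suc (toℕ v)                                   ≡⟨ *-identityˡ _ ⟨
      1 * suc (toℕ v)                               ≡⟨ cong (_* suc (toℕ v)) (lookup-replicate a 1) ⟨
      lookup (replicate (suc k) 1) a * suc (toℕ v)  ∎
      where open ≡-Reasoning

sparse⇒avoids : ∀ {n} k (e : Vec ℕ n) → IsInversionSequence e →
  Sparse k e → Avoids e (zeroThenOnes (suc k))
sparse⇒avoids {n} k e inv sparse (ι , ι< , iso) =
  <-irrefl refl (≤-trans (increasing⇒≤∣∣ (occurrences e x) (ι ∘ suc) (ι< ∘ s<s) ι∈) bounded)
  where
  -- The value at the first one of the pattern; the other ones repeat it, giving `suc k`
  -- occurrences.
  x = lookup e (ι (suc zero))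
  e∘ι : ∀ a → lookup (tabulate (lookup e ∘ ι)) a ≡ lookup e (ι a)
  e∘ι = lookup∘tabulate (lookup e ∘ ι)
  0<x : 0 < x
  0<x = ≤-<-trans z≤n (subst₂ _<_ (e∘ι zero) (e∘ι (suc zero))
    (Equivalence.from (proj₁ (iso zero (suc zero))) z<s))
  x<1+n : x < suc n
  x<1+n = <-≤-trans (inv (ι (suc zero))) (<⇒≤ (s<s (Fin.toℕ<n (ι (suc zero)))))
  bounded : ∣ occurrences e x ∣ ≤ k
  bounded = subst (λ x → ∣ occurrences e x ∣ ≤ k) (Fin.toℕ-fromℕ< x<1+n)
    (sparse (fromℕ< x<1+n) λ eq → <-irrefl (trans (sym (cong toℕ eq)) (Fin.toℕ-fromℕ< x<1+n)) 0<x)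
  ι∈ : ∀ a → ι (suc a) ∈ occurrences e x
  ι∈ a = ∈-occurrences⁺ e (trans (sym (e∘ι (suc a))) (trans
    (Equivalence.from (proj₁ (proj₂ (iso (suc a) (suc zero)))) (lookup-replicate a 1))
    (e∘ι (suc zero))))

-- Rooted trees

module _ {N} (t : RootedDigraph N) where
  open RootedDigraph t

  -- `Star` exposes the first edge of a path, while arguments about parents need the last.
  data SnocView : ∀ {u v} → Path u v → Set where
    []   : ∀ {u} → SnocView (ε {x = u})
    _∷ʳ_ : ∀ {u v w} (p : Path u v) (e : v HasChild w) → SnocView (p ◅◅ (e ◅ ε))

  snocView : ∀ {u v} (p : Path u v) → SnocView p
  snocView ε = []
  snocView (e ◅ p) with snocView p
  ... | []      = ε ∷ʳ e
  ... | q ∷ʳ e′ = (e ◅ q) ∷ʳ e′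

  EdgesIncrease : Set
  EdgesIncrease = ∀ u v → u HasChild v → u Fin.< v

  ParentsUnique : Set
  ParentsUnique = ∀ u u′ v → u HasChild v → u′ HasChild v → u ≡ u′

  module _ (increasing : EdgesIncrease) where

    path⇒≤ : ∀ {u v} → Path u v → u Fin.≤ v
    path⇒≤ ε       = ≤-refl
    path⇒≤ (e ◅ p) = ≤-trans (<⇒≤ (increasing _ _ e)) (path⇒≤ p)

    edgesIncrease⇒linked : ∀ {u v} (p : Path u v) → Linked Fin._<_ (labels p)
    edgesIncrease⇒linked ε             = [-]
    edgesIncrease⇒linked (e ◅ ε)       = increasing _ _ e ∷ [-]
    edgesIncrease⇒linked (e ◅ e′ ◅ p)  = increasing _ _ e ∷ edgesIncrease⇒linked (e′ ◅ p)

    -- Induction on the endpoint: last edges start at its unique parent, whose label is smaller. An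
    -- empty path never meets a nonempty one, as the latter would lead from a vertex to itself with
    -- increasing labels.
    paths-unique : ParentsUnique → ∀ {u v} (p q : Path u v) → p ≡ q
    paths-unique unique p q = go (<-wellFounded _) p q
      where
      go : ∀ {u v} → Acc Fin._<_ v → (p q : Path u v) → p ≡ q
      go (acc rs) p q with snocView p | snocView q
      ... | []     | []      = refl
      ... | []     | q ∷ʳ e  = contradiction (≤-<-trans (path⇒≤ q) (increasing _ _ e)) (<-irrefl refl)
      ... | p ∷ʳ e | []      = contradiction (≤-<-trans (path⇒≤ p) (increasing _ _ e)) (<-irrefl refl)
      ... | p ∷ʳ e | q ∷ʳ e′ with unique _ _ _ e e′
      -- Edges are membership proofs, and any two for the same vertex coincide.
      ... | refl = cong₂ (λ p e → p ◅◅ (e ◅ ε)) (go (rs (increasing _ _ e)) p q) ([]=-irrelevant e e′)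

  linked-suffix : ∀ {u v w} (p : Path u v) (q : Path v w) →
    Linked Fin._<_ (labels (p ◅◅ q)) → Linked Fin._<_ (labels q)
  linked-suffix ε       q l = l
  linked-suffix (_ ◅ p) q l = linked-suffix p q (Linked.tail l)

  linked⇒first-edge< : ∀ {u v w} (e : u HasChild v) (p : Path v w) →
    Linked Fin._<_ (labels (e ◅ p)) → u Fin.< v
  linked⇒first-edge< e ε       l = Linked.head l
  linked⇒first-edge< e (_ ◅ p) l = Linked.head l

  pathLength : ∀ {u v} → Path u v → ℕ
  pathLength ε       = 0
  pathLength (_ ◅ p) = suc (pathLength p)

  pathLength-snoc : ∀ {u v w} (p : Path u v) (e : v HasChild w) →
    pathLength (p ◅◅ (e ◅ ε)) ≡ suc (pathLength p)
  pathLength-snoc ε       e = refl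
  pathLength-snoc (_ ◅ p) e = cong suc (pathLength-snoc p e)

  -- The default `d` survives only on the empty path: each edge replaces it by its own source,
  -- leaving the source of the last edge.
  penultimate : ∀ {u v} → Fin N → Path u v → Fin N
  penultimate d ε             = d
  penultimate d (_◅_ {u} e p) = penultimate u p

  penultimate-snoc : ∀ {u v w} d (p : Path u v) (e : v HasChild w) →
    penultimate d (p ◅◅ (e ◅ ε)) ≡ v
  penultimate-snoc d ε             e = refl
  penultimate-snoc d (_◅_ {u} _ p) e = penultimate-snoc u p e

  module _ (tree : IsRootedTree t) where

    rootPath : ∀ v → Path root v
    rootPath v = proj₁ (tree v)

    rootPath-snoc : ∀ {u v} (e : u HasChild v) → rootPath v ≡ rootPath u ◅◅ (e ◅ ε)
    rootPath-snoc {u} {v} e = proj₂ (tree v) (rootPath u ◅◅ (e ◅ ε))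

    -- Extending the root paths of `u` and `u′` by their edges gives the same path to `v`, from
    -- which `penultimate` reads off both parents.
    parentsUnique : ParentsUnique
    parentsUnique u u′ v e e′ = begin
      u                                            ≡⟨ penultimate-snoc root (rootPath u) e ⟨
      penultimate root (rootPath u ◅◅ (e ◅ ε))     ≡⟨ cong (penultimate root) (rootPath-snoc e) ⟨
      penultimate root (rootPath v)                ≡⟨ cong (penultimate root) (rootPath-snoc e′) ⟩
      penultimate root (rootPath u′ ◅◅ (e′ ◅ ε))   ≡⟨ penultimate-snoc root (rootPath u′) e′ ⟩
      u′                                           ∎
      where open ≡-Reasoning

    depth : Fin N → ℕ
    depth v = pathLength (rootPath v)

    edge⇒depth< : ∀ {u v} → u HasChild v → depth u < depth v
    edge⇒depth< {u} e =
      ≤-reflexive (sym (trans (cong pathLength (rootPath-snoc e)) (pathLength-snoc (rootPath u) e)))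

    -- Descending through arbitrary children stops, because depth grows along edges and there are
    -- finitely many vertices. Depth serves here since labels are not yet known to increase along
    -- edges.
    leafBelow : ∀ v → ∃ λ w → IsLeaf w × Path v w
    leafBelow v = go (spo-noetherian (On.isStrictPartialOrder depth <-isStrictPartialOrder) v)
      where
      go : ∀ {v} → Acc (flip (λ u w → depth u < depth w)) v → ∃ λ w → IsLeaf w × Path v w
      go {v} (acc rs) with nonempty? (children v)
      ... | no  leaf    = v , leaf , ε
      ... | yes (u , e) = let w , leaf , p = go (rs (edge⇒depth< e)) in w , leaf , e ◅ p

    -- Monotonicity is only given along paths ending in a leaf, so a given edge has
    -- to be extended down to some leaf.
    labelIncreasing⇒edgesIncrease : IsLabelIncreasing t → EdgesIncrease
    labelIncreasing⇒edgesIncrease labelIncreasing u v e =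
      let w , leaf , p = leafBelow v in
      linked⇒first-edge< e p (linked-suffix (rootPath u) (e ◅ p)
        (labelIncreasing leaf (rootPath u ◅◅ (e ◅ p))))

-- The tree of an inversion sequence

-- The leading `outside` keeps vertex 0 from being a child and moves position `i` to vertex `suc i`.
toTree : ∀ {n} → Vec ℕ n → RootedDigraph (suc n)
toTree e = rooted zero (tabulate λ v → outside ∷ occurrences e (toℕ v))

module _ {n} (e : Vec ℕ n) where
  open RootedDigraph (toTree e)

  children-toTree : ∀ v → children v ≡ outside ∷ occurrences e (toℕ v)
  children-toTree = lookup∘tabulate _

  edge⁺ : ∀ u {i} → lookup e i ≡ toℕ u → u HasChild suc i
  edge⁺ u eq = subst (_ ∈_) (sym (children-toTree u)) (there (∈-occurrences⁺ e eq))

  edge⁻ : ∀ u {i} → u HasChild suc i → lookup e i ≡ toℕ u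
  edge⁻ u i∈ with there i∈′ ← subst (_ ∈_) (children-toTree u) i∈ = ∈-occurrences⁻ e i∈′

  childless-zero : ∀ u → ¬ u HasChild zero
  childless-zero u 0∈ with () ← subst (zero ∈_) (children-toTree u) 0∈

  toTree-parentsUnique : ParentsUnique (toTree e)
  toTree-parentsUnique u u′ zero    u→v _    = contradiction u→v (childless-zero u)
  toTree-parentsUnique u u′ (suc i) u→v u′→v = Fin.toℕ-injective (trans (sym (edge⁻ u u→v)) (edge⁻ u′ u′→v))

  -- A leading `outside` does not change the cardinality, by computation, so rewriting the child
  -- sets suffices.
  sparse⇔toTree : ∀ k → Sparse k e ⇔ (∀ v → v ≢ zero → ∣ children v ∣ ≤ k)
  sparse⇔toTree k = mk⇔
    (λ s v v≢0 → subst (λ c → ∣ c ∣ ≤ k) (sym (children-toTree v)) (s v v≢0))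
    (λ s v v≢0 → subst (λ c → ∣ c ∣ ≤ k) (children-toTree v) (s v v≢0))

  module _ (inv : IsInversionSequence e) where

    toTree-edgesIncrease : EdgesIncrease (toTree e)
    toTree-edgesIncrease u zero    u→v = contradiction u→v (childless-zero u)
    toTree-edgesIncrease u (suc i) u→v = subst (_< suc (toℕ i)) (edge⁻ u u→v) (inv i)

    parent : Fin n → Fin (suc n)
    parent i = fromℕ< (<-trans (inv i) (s<s (Fin.toℕ<n i)))

    toℕ-parent : ∀ i → toℕ (parent i) ≡ lookup e i
    toℕ-parent i = Fin.toℕ-fromℕ< _

    parent-edge : ∀ i → parent i HasChild suc i
    parent-edge i = edge⁺ (parent i) (sym (toℕ-parent i))

    toTree-isRootedTree : IsRootedTree (toTree e)
    toTree-isRootedTree v = path (<-wellFounded v) ,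
      paths-unique (toTree e) toTree-edgesIncrease toTree-parentsUnique _
      where
      -- Climbing from parent to parent lowers the label, hence ends at vertex 0.
      path : ∀ {v} → Acc Fin._<_ v → Path zero v
      path {zero}  _        = ε
      path {suc i} (acc rs) = path (rs (toTree-edgesIncrease (parent i) (suc i) (parent-edge i))) ◅◅ (parent-edge i ◅ ε)

    toTree∈L′ : ∀ {k} → Sparse k e → L′ (suc n) k (toTree e)
    toTree∈L′ sparse = toTree-isRootedTree
      , (λ _ → edgesIncrease⇒linked (toTree e) toTree-edgesIncrease)
      , Equivalence.to (sparse⇔toTree _) sparse

-- Recovering the inversion sequence from its tree

lookup-ext : ∀ {a} {A : Set a} {n} {xs ys : Vec A n} →
  (∀ i → lookup xs i ≡ lookup ys i) → xs ≡ ys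
lookup-ext {xs = xs} {ys} eq =
  trans (sym (tabulate∘lookup xs)) (trans (tabulate-cong eq) (tabulate∘lookup ys))

-- The edge into `suc i`, transported to the other tree, starts at the vertex labelled by the entry
-- at `i` of either sequence.
toTree-injective : ∀ {n} {e e′ : Vec ℕ n} → IsInversionSequence e → toTree e ≡ toTree e′ → e ≡ e′
toTree-injective {e = e} {e′} inv eq = lookup-ext λ i → trans (sym (toℕ-parent e inv i))
  (sym (edge⁻ e′ (parent e inv i) (subst (λ t → RootedDigraph._HasChild_ t (parent e inv i) (suc i)) eq (parent-edge e inv i))))

-- The sequence lists the labels of the parents of 1, ..., n. Increasing edges make it an inversion
-- sequence, and uniqueness of parents makes the child sets agree.
toTree-surjective : ∀ {n k} {t : RootedDigraph (suc n)} → L′ (suc n) k t →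
  ∃ λ e → (IsInversionSequence e × Sparse k e) × toTree e ≡ t
toTree-surjective {n} {k} {t} (tree , labelIncreasing , bounded) =
  e , (inv , sparse) , toTree-e≡t
  where
  open RootedDigraph t

  increasing : EdgesIncrease t
  increasing = labelIncreasing⇒edgesIncrease t tree labelIncreasing

  -- Labels do not decrease along the path from the root to vertex 0.
  root≡0 : root ≡ zero
  root≡0 = Fin.toℕ-injective (n≤0⇒n≡0 (path⇒≤ t increasing (rootPath t tree zero)))

  parentOf : ∀ i → ∃ λ u → u HasChild suc i
  parentOf i = go root≡0 (rootPath t tree (suc i))
    where
    -- With the root generalised to a variable, the empty path can unify it with `suc i`,
    -- contradicting `r ≡ zero`.
    go : ∀ {r} → r ≡ zero → Path r (suc i) → ∃ λ u → u HasChild suc i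
    go r≡0 p with snocView t p
    go ()  _ | []
    go _   _ | _ ∷ʳ edge = _ , edge

  e : Vec ℕ n
  e = tabulate λ i → toℕ (proj₁ (parentOf i))

  lookup-e : ∀ i → lookup e i ≡ toℕ (proj₁ (parentOf i))
  lookup-e = lookup∘tabulate _

  inv : IsInversionSequence e
  inv i = subst (_< suc (toℕ i)) (sym (lookup-e i)) (increasing _ _ (proj₂ (parentOf i)))

  open RootedDigraph (toTree e) using () renaming (children to childrenₑ)

  children⊆ : ∀ u → childrenₑ u ⊆ children u
  children⊆ u {zero}  0∈ = contradiction 0∈ (childless-zero e u)
  children⊆ u {suc i} i∈ = subst (_HasChild suc i)
    (Fin.toℕ-injective (trans (sym (lookup-e i)) (edge⁻ e u i∈))) (proj₂ (parentOf i))

  children⊇ : ∀ u → children u ⊆ childrenₑ u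
  children⊇ u {zero}  0∈ = contradiction (increasing _ _ 0∈) n≮0
  children⊇ u {suc i} i∈ = edge⁺ e u
    (trans (lookup-e i) (cong toℕ (parentsUnique t tree _ _ _ (proj₂ (parentOf i)) i∈)))

  toTree-e≡t : toTree e ≡ t
  toTree-e≡t = cong₂ rooted (sym root≡0)
    (lookup-ext λ u → ⊆-antisym (children⊆ u) (children⊇ u))

  sparse : Sparse k e
  -- Transport along the equality of trees turns the exempted root into `zero`, the value exempted
  -- by `Sparse`.
  sparse = Equivalence.from (sparse⇔toTree e k)
    (subst (λ t → ∀ v → v ≢ RootedDigraph.root t → ∣ RootedDigraph.children t v ∣ ≤ k) (sym toTree-e≡t) bounded)

-- Equality of the two cardinalities

theorem4p2 : ∀ (k : ℕ) → 1 ≤ k → ∀ (n : ℕ) → 1 ≤ n →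
    ∃ λ (c : ℕ) → HasCardinality (𝐈 n (zeroThenOnes k)) c × HasCardinality (L′ (suc n) (k ∸ 1)) c
theorem4p2 (suc k) _ n _ =
  let c , card = decidable⇒HasCardinality (≡-dec _≟_) 𝐈? (boundedVecs n n) λ {e} (inv , _) →
        -- Each entry is at most its position, hence below `n`.
        ∈-boundedVecs e λ i → <-≤-trans (inv i) (Fin.toℕ<n i)
  in c , card , HasCardinality-bijection toTree
       (λ {e} (inv , avoids) → toTree∈L′ e inv (avoids⇒sparse k e inv avoids))
       (λ (inv , _) _ → toTree-injective inv)
       (λ t∈L′ → let e , (inv , sparse) , eq = toTree-surjective t∈L′ in
                 e , (inv , sparse⇒avoids k e inv sparse) , eq)
       card
  where
  𝐈? : Decidable (𝐈 n (zeroThenOnes (suc k)))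
  -- Avoidance quantifies over maps of positions; it is decided through sparsity, which checks
  -- finitely many values.
  𝐈? e = map′ (λ (inv , sparse) → inv , sparse⇒avoids k e inv sparse)
              (λ (inv , avoids) → inv , avoids⇒sparse k e inv avoids)
              (inversionSequence? e ×-dec sparse? k e)
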